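{- Let $a,b\in\mathbb{C}$ and let $\{P_n(x)\}_{n=0}^{\infty}$ be the polynomial sequence generated by $$\sum_{n=0}^{\infty}P_n(x)\frac{z^n}{n!}=e^{xz+az^2+bz^4}.$$ Then for every $n\ge 4$, $$P_n(x)=xP_{n-1}(x)+2a\binom{n-1}{1}P_{n-2}(x)+24b\binom{n-1}{3}P_{n-4}(x),$$ where $P_0(x)=1$, $P_1(x)=x$, $P_2(x)=2a+x^2$, and $P_3(x)=6ax+x^3$.
   Context: The generating relation is an identity of formal power series in $z$: $P_n(x)/n!$ is the coefficient of $z^n$ in $e^{xz+az^2+bz^4}$. -}

module Defs where

open import Algebra.Bundles using (CommutativeRing)
open import Algebra.Consequences.Setoid using (comm∧distrˡ⇒distrʳ; comm∧idˡ⇒idʳ)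
import Algebra.Properties.Monoid.Sum as Sum
import Algebra.Properties.Ring as RingProperties
import Algebra.Properties.Semiring.Exp as SemiringExp
import Algebra.Properties.Semiring.Mult as SemiringMult
import Algebra.Solver.Ring.NaturalCoefficients.Default as SemiringSolver
open import Data.Fin.Base using (toℕ)
open import Data.Integer.Base using (+_)
open import Data.Nat.Base as ℕ using (ℕ; zero; suc; _∸_; z≤n; s≤s; _!)
import Data.Nat.Properties as ℕ
open import Data.Product.Base using (∃; _×_; _,_)
open import Data.Rational.Base as ℚ using (ℚ; 0ℚ; 1ℚ; ½; ∣_∣)
import Data.Rational.Properties as ℚ
open import Data.Rational.Solver using (module +-*-Solver)
open import Level using (0ℓ; _⊔_)
open import Relation.Binary.PropositionalEquality.Core as ≡ using (_≡_; cong; subst)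
import Relation.Binary.Reasoning.Setoid as SetoidReasoning
open import Relation.Binary.Bundles using (Setoid)
open import Relation.Binary.Structures using (IsEquivalence)

module PowerSeries {c ℓ} (R : CommutativeRing c ℓ) where

  open CommutativeRing R hiding (zero)
  open Sum +-monoid using (sum⁺-syntax)
  open SetoidReasoning setoid

  open SemiringSolver commutativeSemiring using (solve; con; _:+_; _:*_; _:=_)

  -- f n is the coefficient of zⁿ.
  Series : Set c
  Series = ℕ → Carrier

  infix 4 _≈ₛ_
  _≈ₛ_ : Series → Series → Set ℓ
  f ≈ₛ g = ∀ n → f n ≈ g n

  infixl 6 _+ₛ_
  infixl 7 _*ₛ_

  _+ₛ_ : Series → Series → Series
  (f +ₛ g) n = f n + g n

  -ₛ_ : Series → Series
  (-ₛ f) n = - f n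

  _*ₛ_ : Series → Series → Series
  (f *ₛ g) n = ∑[ i ≤ n ] (f (toℕ i) * g (n ∸ toℕ i))

  -- monomial a k is a zᵏ.
  monomial : Carrier → ℕ → Series
  monomial a zero    zero    = a
  monomial a zero    (suc n) = 0#
  monomial a (suc k) zero    = 0#
  monomial a (suc k) (suc n) = monomial a k n

  0ₛ 1ₛ : Series
  0ₛ n = 0#
  1ₛ   = monomial 1# 0

  tail : Series → Series
  tail f n = f (suc n)

  *ₛ-cong : ∀ {f f′ g g′} → f ≈ₛ f′ → g ≈ₛ g′ → f *ₛ g ≈ₛ f′ *ₛ g′
  *ₛ-cong p q zero    = +-congʳ (*-cong (p 0) (q 0))
  *ₛ-cong p q (suc n) = +-cong (*-cong (p 0) (q (suc n))) (*ₛ-cong (λ i → p (suc i)) q n)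

  *ₛ-zeroˡ : ∀ {f} → f ≈ₛ 0ₛ → ∀ g → f *ₛ g ≈ₛ 0ₛ
  *ₛ-zeroˡ p g zero    = trans (+-identityʳ _) (trans (*-congʳ (p 0)) (zeroˡ _))
  *ₛ-zeroˡ p g (suc n) = trans
    (+-cong (trans (*-congʳ (p 0)) (zeroˡ _)) (*ₛ-zeroˡ (λ i → p (suc i)) g n))
    (+-identityʳ 0#)

  *ₛ-distribʳ : ∀ h f g → (f +ₛ g) *ₛ h ≈ₛ f *ₛ h +ₛ g *ₛ h
  *ₛ-distribʳ h f g zero    = lemma (f 0) (g 0) (h 0)
    where
    lemma : ∀ x y z → (x + y) * z + 0# ≈ (x * z + 0#) + (y * z + 0#)
    lemma = solve 3 (λ x y z → (x :+ y) :* z :+ con 0 := (x :* z :+ con 0) :+ (y :* z :+ con 0)) refl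
  *ₛ-distribʳ h f g (suc n) =
    trans (+-congˡ (*ₛ-distribʳ h (tail f) (tail g) n)) (lemma _ _ _ _ _)
    where
    lemma : ∀ x y z u v → (x + y) * z + (u + v) ≈ (x * z + u) + (y * z + v)
    lemma = solve 5 (λ x y z u v → (x :+ y) :* z :+ (u :+ v) := (x :* z :+ u) :+ (y :* z :+ v)) refl

  scale-*ₛ : ∀ a f g n → ((λ i → a * f i) *ₛ g) n ≈ a * (f *ₛ g) n
  scale-*ₛ a f g zero    = lemma a (f 0) (g 0)
    where
    lemma : ∀ x y z → x * y * z + 0# ≈ x * (y * z + 0#)
    lemma = solve 3 (λ x y z → x :* y :* z :+ con 0 := x :* (y :* z :+ con 0)) refl
  scale-*ₛ a f g (suc n) = trans (+-congˡ (scale-*ₛ a (tail f) g n)) (lemma _ _ _ _)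
    where
    lemma : ∀ x y z u → x * y * z + x * u ≈ x * (y * z + u)
    lemma = solve 4 (λ x y z u → x :* y :* z :+ x :* u := x :* (y :* z :+ u)) refl

  *ₛ-assoc : ∀ f g h → (f *ₛ g) *ₛ h ≈ₛ f *ₛ (g *ₛ h)
  *ₛ-assoc f g h zero    = lemma (f 0) (g 0) (h 0)
    where
    lemma : ∀ x y z → (x * y + 0#) * z + 0# ≈ x * (y * z + 0#) + 0#
    lemma = solve 3 (λ x y z → (x :* y :+ con 0) :* z :+ con 0 := x :* (y :* z :+ con 0) :+ con 0) refl
  *ₛ-assoc f g h (suc n) = begin
    (f 0 * g 0 + 0#) * h (suc n) + (tail (f *ₛ g) *ₛ h) n
      ≈⟨ +-congˡ (*ₛ-distribʳ h (λ i → f 0 * tail g i) (tail f *ₛ g) n) ⟩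
    (f 0 * g 0 + 0#) * h (suc n) + (((λ i → f 0 * tail g i) *ₛ h) n + ((tail f *ₛ g) *ₛ h) n)
      ≈⟨ +-congˡ (+-cong (scale-*ₛ (f 0) (tail g) h n) (*ₛ-assoc (tail f) g h n)) ⟩
    (f 0 * g 0 + 0#) * h (suc n) + (f 0 * (tail g *ₛ h) n + (tail f *ₛ (g *ₛ h)) n)
      ≈⟨ lemma (f 0) (g 0) (h (suc n)) _ _ ⟩
    f 0 * (g *ₛ h) (suc n) + (tail f *ₛ (g *ₛ h)) n ∎
    where
    lemma : ∀ x y z u v → (x * y + 0#) * z + (x * u + v) ≈ x * (y * z + u) + v
    lemma = solve 5 (λ x y z u v → (x :* y :+ con 0) :* z :+ (x :* u :+ v) := x :* (y :* z :+ u) :+ v) refl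

  *ₛ-tailʳ : ∀ f g n → (f *ₛ g) (suc n) ≈ g 0 * f (suc n) + (f *ₛ tail g) n
  *ₛ-tailʳ f g zero    = lemma (f 0) (g 1) (f 1) (g 0)
    where
    lemma : ∀ x y z u → x * y + (z * u + 0#) ≈ u * z + (x * y + 0#)
    lemma = solve 4 (λ x y z u → x :* y :+ (z :* u :+ con 0) := u :* z :+ (x :* y :+ con 0)) refl
  *ₛ-tailʳ f g (suc n) = trans (+-congˡ (*ₛ-tailʳ (tail f) g n)) (lemma _ _ _)
    where
    lemma : ∀ x y z → x + (y + z) ≈ y + (x + z)
    lemma = solve 3 (λ x y z → x :+ (y :+ z) := y :+ (x :+ z)) refl

  *ₛ-comm : ∀ f g → f *ₛ g ≈ₛ g *ₛ f
  *ₛ-comm f g zero    = +-congʳ (*-comm _ _)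
  *ₛ-comm f g (suc n) = trans (+-congˡ (*ₛ-comm (tail f) g n)) (sym (*ₛ-tailʳ g f n))

  *ₛ-identityˡ : ∀ f → 1ₛ *ₛ f ≈ₛ f
  *ₛ-identityˡ f zero    = trans (+-identityʳ _) (*-identityˡ _)
  *ₛ-identityˡ f (suc n) =
    trans (+-cong (*-identityˡ _) (*ₛ-zeroˡ (λ _ → refl) f n)) (+-identityʳ _)

  seriesRing : CommutativeRing c ℓ
  seriesRing = record
    { Carrier = Series ; _≈_ = _≈ₛ_ ; _+_ = _+ₛ_ ; _*_ = _*ₛ_ ; -_ = -ₛ_ ; 0# = 0ₛ ; 1# = 1ₛ
    ; isCommutativeRing = record
      { isRing = record
        { +-isAbelianGroup = record
          { isGroup = record
            { isMonoid = record
              { isSemigroup = record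
                { isMagma = record
                  { isEquivalence = record
                    { refl  = λ _ → refl
                    ; sym   = λ p n → sym (p n)
                    ; trans = λ p q n → trans (p n) (q n)
                    }
                  ; ∙-cong = λ p q n → +-cong (p n) (q n)
                  }
                ; assoc = λ f g h n → +-assoc (f n) (g n) (h n)
                }
              ; identity = (λ f n → +-identityˡ (f n)) , (λ f n → +-identityʳ (f n))
              }
            ; inverse = (λ f n → -‿inverseˡ (f n)) , (λ f n → -‿inverseʳ (f n))
            ; ⁻¹-cong = λ p n → -‿cong (p n)
            }
          ; comm = λ f g n → +-comm (f n) (g n)
          }
        ; *-cong     = *ₛ-cong
        ; *-assoc    = *ₛ-assoc
        ; *-identity = *ₛ-identityˡ
                     , (λ f n → trans (*ₛ-comm f 1ₛ n) (*ₛ-identityˡ f n))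
        ; distrib    = (λ f g h n → trans (*ₛ-comm f (g +ₛ h) n)
                          (trans (*ₛ-distribʳ f g h n) (+-cong (*ₛ-comm g f n) (*ₛ-comm h f n))))
                     , *ₛ-distribʳ
        }
      ; *-comm = *ₛ-comm
      }
    }

  open SemiringExp (CommutativeRing.semiring seriesRing) public using () renaming (_^_ to _^ₛ_)

  *ₛ-vanish : ∀ {f g} d e → (∀ n → n ℕ.< d → f n ≈ 0#) → (∀ n → n ℕ.< e → g n ≈ 0#) →
              ∀ n → n ℕ.< d ℕ.+ e → (f *ₛ g) n ≈ 0#
  *ₛ-vanish zero e p q zero n<e =
    trans (+-identityʳ _) (trans (*-congˡ (q 0 n<e)) (zeroʳ _))
  *ₛ-vanish {f} {g} zero e p q (suc n) n<e = trans
    (+-cong (trans (*-congˡ (q (suc n) n<e)) (zeroʳ _))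
            (*ₛ-vanish {tail f} {g} zero e (λ _ ()) q n (ℕ.<-trans (ℕ.n<1+n n) n<e)))
    (+-identityʳ 0#)
  *ₛ-vanish (suc d) e p q zero n<e =
    trans (+-identityʳ _) (trans (*-congʳ (p 0 (s≤s z≤n))) (zeroˡ _))
  *ₛ-vanish {f} {g} (suc d) e p q (suc n) (s≤s n<e) = trans
    (+-cong (trans (*-congʳ (p 0 (s≤s z≤n))) (zeroˡ _))
            (*ₛ-vanish {tail f} {g} d e (λ i i<d → p (suc i) (s≤s i<d)) q n n<e))
    (+-identityʳ 0#)

  ^ₛ-vanish : ∀ {f} → f 0 ≈ 0# → ∀ k n → n ℕ.< k → (f ^ₛ k) n ≈ 0#
  ^ₛ-vanish {f} p (suc k) = *ₛ-vanish {f} {f ^ₛ k} 1 k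
    (λ { zero _ → p ; (suc _) (s≤s ()) }) (^ₛ-vanish {f} p k)

module Polynomials {c ℓ} (R : CommutativeRing c ℓ) where

  open CommutativeRing R hiding (zero)
  open PowerSeries R

  -- vanish only asks for zeros from index bound on: bound is an upper estimate of degree + 1,
  -- and _≈ₚ_ ignores it.
  record Polynomial : Set (c ⊔ ℓ) where
    no-eta-equality
    field
      coeff  : ℕ → Carrier
      bound  : ℕ
      vanish : ∀ n → bound ℕ.≤ n → coeff n ≈ 0#

  open Polynomial public

  infix 4 _≈ₚ_
  record _≈ₚ_ (p q : Polynomial) : Set ℓ where
    constructor mk≈ₚ
    field
      coeff-≈ : ∀ n → coeff p n ≈ coeff q n

  open _≈ₚ_ public

  monomial-vanish : ∀ a k n → suc k ℕ.≤ n → monomial a k n ≈ 0#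
  monomial-vanish a zero    (suc n) _         = refl
  monomial-vanish a (suc k) (suc n) (s≤s k<n) = monomial-vanish a k n k<n

  *ₛ-bounded : ∀ f g d e → (∀ n → d ℕ.≤ n → f n ≈ 0#) → (∀ n → e ℕ.≤ n → g n ≈ 0#) →
               ∀ n → d ℕ.+ e ℕ.≤ n → (f *ₛ g) n ≈ 0#
  *ₛ-bounded f g zero    e p q n       _         = *ₛ-zeroˡ (λ i → p i z≤n) g n
  *ₛ-bounded f g (suc d) e p q (suc n) (s≤s d+e≤n) = trans
    (+-cong (trans (*-congˡ (q (suc n) (ℕ.m≤n⇒m≤1+n (ℕ.m+n≤o⇒n≤o d d+e≤n)))) (zeroʳ _))
            (*ₛ-bounded (tail f) g d e (λ i d≤i → p (suc i) (s≤s d≤i)) q n d+e≤n))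
    (+-identityʳ 0#)

  infixl 6 _+ₚ_
  infixl 7 _*ₚ_

  _+ₚ_ : Polynomial → Polynomial → Polynomial
  coeff  (p +ₚ q) = coeff p +ₛ coeff q
  bound  (p +ₚ q) = bound p ℕ.⊔ bound q
  vanish (p +ₚ q) n le = trans
    (+-cong (vanish p n (ℕ.m⊔n≤o⇒m≤o (bound p) (bound q) le))
            (vanish q n (ℕ.m⊔n≤o⇒n≤o (bound p) (bound q) le)))
    (+-identityʳ 0#)

  -ₚ_ : Polynomial → Polynomial
  coeff  (-ₚ p) = -ₛ coeff p
  bound  (-ₚ p) = bound p
  vanish (-ₚ p) n le =
    trans (-‿cong (vanish p n le)) (trans (sym (+-identityʳ (- 0#))) (-‿inverseˡ 0#))

  _*ₚ_ : Polynomial → Polynomial → Polynomial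
  coeff  (p *ₚ q) = coeff p *ₛ coeff q
  bound  (p *ₚ q) = bound p ℕ.+ bound q
  vanish (p *ₚ q) =
    *ₛ-bounded (coeff p) (coeff q) (bound p) (bound q) (vanish p) (vanish q)

  const : Carrier → Polynomial
  coeff  (const a) = monomial a 0
  bound  (const a) = 1
  vanish (const a) = monomial-vanish a 0

  X : Polynomial
  coeff  X = monomial 1# 1
  bound  X = 2
  vanish X = monomial-vanish 1# 1

  0ₚ 1ₚ : Polynomial
  coeff  0ₚ = 0ₛ
  bound  0ₚ = 0
  vanish 0ₚ _ _ = refl
  1ₚ = const 1#

  private module S = CommutativeRing seriesRing

  polynomialRing : CommutativeRing (c ⊔ ℓ) ℓ
  polynomialRing = record
    { Carrier = Polynomial ; _≈_ = _≈ₚ_ ; _+_ = _+ₚ_ ; _*_ = _*ₚ_ ; -_ = -ₚ_ ; 0# = 0ₚ ; 1# = 1ₚ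
    ; isCommutativeRing = record
      { isRing = record
        { +-isAbelianGroup = record
          { isGroup = record
            { isMonoid = record
              { isSemigroup = record
                { isMagma = record
                  { isEquivalence = record
                    { refl  = mk≈ₚ λ _ → refl
                    ; sym   = λ e → mk≈ₚ λ n → sym (coeff-≈ e n)
                    ; trans = λ e e′ → mk≈ₚ λ n → trans (coeff-≈ e n) (coeff-≈ e′ n)
                    }
                  ; ∙-cong = λ e e′ → mk≈ₚ λ n → +-cong (coeff-≈ e n) (coeff-≈ e′ n)
                  }
                ; assoc = λ p q r → mk≈ₚ (S.+-assoc (coeff p) (coeff q) (coeff r))
                }
              ; identity = (λ p → mk≈ₚ (S.+-identityˡ (coeff p)))
                         , (λ p → mk≈ₚ (S.+-identityʳ (coeff p)))
              }
            ; inverse = (λ p → mk≈ₚ (S.-‿inverseˡ (coeff p)))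
                      , (λ p → mk≈ₚ (S.-‿inverseʳ (coeff p)))
            ; ⁻¹-cong = λ e → mk≈ₚ λ n → -‿cong (coeff-≈ e n)
            }
          ; comm = λ p q → mk≈ₚ (S.+-comm (coeff p) (coeff q))
          }
        ; *-cong     = λ e e′ → mk≈ₚ (*ₛ-cong (coeff-≈ e) (coeff-≈ e′))
        ; *-assoc    = λ p q r → mk≈ₚ (S.*-assoc (coeff p) (coeff q) (coeff r))
        ; *-identity = (λ p → mk≈ₚ (S.*-identityˡ (coeff p)))
                     , (λ p → mk≈ₚ (S.*-identityʳ (coeff p)))
        ; distrib    = (λ p q r → mk≈ₚ (S.distribˡ (coeff p) (coeff q) (coeff r)))
                     , (λ p q r → mk≈ₚ (S.distribʳ (coeff p) (coeff q) (coeff r)))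
        }
      ; *-comm = λ p q → mk≈ₚ (*ₛ-comm (coeff p) (coeff q))
      }
    }

1/_! : ℕ → ℚ
1/ n ! = (+ 1 ℚ./ (n !)) {{n ℕ.!≢0}}

module Exponential {c ℓ} (R : CommutativeRing c ℓ) (ι : ℚ → CommutativeRing.Carrier R) where

  open CommutativeRing R hiding (zero)
  open Sum +-monoid using (sum⁺-syntax)
  open PowerSeries R

  -- ∑ fᵏ / k!, for f without constant term: then fᵏ has no zⁿ term once k > n
  -- (^ₛ-vanish), so the terms k ≤ n give the whole coefficient of zⁿ.
  exp : Series → Series
  exp f n = ∑[ k ≤ n ] (ι (1/ toℕ k !) * (f ^ₛ toℕ k) n)

  -- ∑ Pₙ zⁿ / n!
  egf : (ℕ → Carrier) → Series
  egf P n = ι (1/ n !) * P n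

-- Reals as Cauchy sequences of rationals, equal when the difference tends to 0.

record ℝ : Set where
  no-eta-equality
  field
    seq    : ℕ → ℚ
    cauchy : ∀ ε → 0ℚ ℚ.< ε → ∃ λ N → ∀ m n → N ℕ.≤ m → N ℕ.≤ n → ∣ seq m ℚ.- seq n ∣ ℚ.< ε

open ℝ public

infix 4 _≈ᵣ_
record _≈ᵣ_ (x y : ℝ) : Set where
  constructor mk≈ᵣ
  field
    close : ∀ ε → 0ℚ ℚ.< ε → ∃ λ N → ∀ n → N ℕ.≤ n → ∣ seq x n ℚ.- seq y n ∣ ℚ.< ε

open _≈ᵣ_ public

module RealLemmas where

  open +-*-Solver using (solve; _:+_; _:*_; _:-_; :-_; _:=_)

  half-pos : ∀ {ε} → 0ℚ ℚ.< ε → 0ℚ ℚ.< ½ ℚ.* ε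
  half-pos {ε} 0<ε = ℚ.positive⁻¹ (½ ℚ.* ε) {{ℚ.pos*pos⇒pos ½ ε {{ℚ.positive 0<ε}}}}

  halves : ∀ ε → ½ ℚ.* ε ℚ.+ ½ ℚ.* ε ≡ ε
  halves ε = ≡.trans (≡.sym (ℚ.*-distribʳ-+ ε ½ ½)) (ℚ.*-identityˡ ε)

  add-< : ∀ u v {ε} → ∣ u ∣ ℚ.< ½ ℚ.* ε → ∣ v ∣ ℚ.< ½ ℚ.* ε → ∣ u ℚ.+ v ∣ ℚ.< ε
  add-< u v {ε} p q = ℚ.≤-<-trans (ℚ.∣p+q∣≤∣p∣+∣q∣ u v)
    (subst (∣ u ∣ ℚ.+ ∣ v ∣ ℚ.<_) (halves ε) (ℚ.+-mono-< p q))

  flip-< : ∀ u v {ε} → ∣ u ℚ.- v ∣ ℚ.< ε → ∣ v ℚ.- u ∣ ℚ.< ε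
  flip-< u v {ε} = subst (ℚ._< ε) (≡.trans (≡.sym (ℚ.∣-p∣≡∣p∣ (u ℚ.- v))) (cong ∣_∣ (lemma u v)))
    where
    lemma : ∀ u v → ℚ.- (u ℚ.- v) ≡ v ℚ.- u
    lemma = solve 2 (λ u v → :- (u :- v) := v :- u) ≡.refl

  trans-< : ∀ u v w {ε} → ∣ u ℚ.- v ∣ ℚ.< ½ ℚ.* ε → ∣ v ℚ.- w ∣ ℚ.< ½ ℚ.* ε → ∣ u ℚ.- w ∣ ℚ.< ε
  trans-< u v w {ε} p q =
    subst (λ t → ∣ t ∣ ℚ.< ε) (lemma u v w) (add-< (u ℚ.- v) (v ℚ.- w) p q)
    where
    lemma : ∀ u v w → (u ℚ.- v) ℚ.+ (v ℚ.- w) ≡ u ℚ.- w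
    lemma = solve 3 (λ u v w → (u :- v) :+ (v :- w) := u :- w) ≡.refl

  sum-< : ∀ u v u′ v′ {ε} → ∣ u ℚ.- u′ ∣ ℚ.< ½ ℚ.* ε → ∣ v ℚ.- v′ ∣ ℚ.< ½ ℚ.* ε →
          ∣ (u ℚ.+ v) ℚ.- (u′ ℚ.+ v′) ∣ ℚ.< ε
  sum-< u v u′ v′ {ε} p q =
    subst (λ t → ∣ t ∣ ℚ.< ε) (lemma u v u′ v′) (add-< (u ℚ.- u′) (v ℚ.- v′) p q)
    where
    lemma : ∀ u v u′ v′ → (u ℚ.- u′) ℚ.+ (v ℚ.- v′) ≡ (u ℚ.+ v) ℚ.- (u′ ℚ.+ v′)
    lemma = solve 4 (λ u v u′ v′ → (u :- u′) :+ (v :- v′) := (u :+ v) :- (u′ :+ v′)) ≡.refl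

  neg-< : ∀ u v {ε} → ∣ u ℚ.- v ∣ ℚ.< ε → ∣ (ℚ.- u) ℚ.- (ℚ.- v) ∣ ℚ.< ε
  neg-< u v {ε} p = subst (λ t → ∣ t ∣ ℚ.< ε) (lemma u v) (flip-< u v p)
    where
    lemma : ∀ u v → v ℚ.- u ≡ (ℚ.- u) ℚ.- (ℚ.- v)
    lemma = solve 2 (λ u v → v :- u := (:- u) :- (:- v)) ≡.refl

  tolerance : ∀ B {ε} → 0ℚ ℚ.< B → 0ℚ ℚ.< ε → ∃ λ δ → 0ℚ ℚ.< δ × δ ℚ.* B ≡ ε
  tolerance B {ε} 0<B 0<ε = ε ℚ.* B⁻¹ , ℚ.positive⁻¹ (ε ℚ.* B⁻¹) , eq
    where
    instance
      _ = ℚ.positive 0<B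
      _ = ℚ.positive 0<ε
      _ = ℚ.pos⇒nonZero B
    B⁻¹ : ℚ
    B⁻¹ = ℚ.1/ B
    instance
      _ = ℚ.1/pos⇒pos B
      _ = ℚ.pos*pos⇒pos ε B⁻¹
    eq : ε ℚ.* B⁻¹ ℚ.* B ≡ ε
    eq = ≡.trans (ℚ.*-assoc ε B⁻¹ B)
           (≡.trans (cong (ε ℚ.*_) (ℚ.*-inverseˡ B)) (ℚ.*-identityʳ ε))

  scale-< : ∀ u b B {δ ε} → 0ℚ ℚ.< B → δ ℚ.* B ≡ ε → ∣ u ∣ ℚ.< δ → ∣ b ∣ ℚ.< B → ∣ u ℚ.* b ∣ ℚ.< ε
  scale-< u b B {δ} 0<B ≡.refl p q = subst (ℚ._< δ ℚ.* B) (≡.sym (ℚ.∣p*q∣≡∣p∣*∣q∣ u b))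
    (ℚ.≤-<-trans (ℚ.*-monoˡ-≤-nonNeg ∣ u ∣ {{ℚ.∣-∣-nonNeg u}} (ℚ.<⇒≤ q))
                 (ℚ.*-monoˡ-<-pos B {{ℚ.positive 0<B}} p))

  product-< : ∀ u v u′ v′ B D {δ η ε} → 0ℚ ℚ.< B → 0ℚ ℚ.< D →
    δ ℚ.* B ≡ ½ ℚ.* ε → η ℚ.* D ≡ ½ ℚ.* ε → ∣ v ∣ ℚ.< B → ∣ u′ ∣ ℚ.< D →
    ∣ u ℚ.- u′ ∣ ℚ.< δ → ∣ v ℚ.- v′ ∣ ℚ.< η → ∣ u ℚ.* v ℚ.- u′ ℚ.* v′ ∣ ℚ.< ε
  product-< u v u′ v′ B D {ε = ε} 0<B 0<D eB eD bv bu′ p q = subst (λ t → ∣ t ∣ ℚ.< ε) (lemma u v u′ v′)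
    (add-< ((u ℚ.- u′) ℚ.* v) ((v ℚ.- v′) ℚ.* u′)
      (scale-< (u ℚ.- u′) v B 0<B eB p bv) (scale-< (v ℚ.- v′) u′ D 0<D eD q bu′))
    where
    lemma : ∀ u v u′ v′ → (u ℚ.- u′) ℚ.* v ℚ.+ (v ℚ.- v′) ℚ.* u′ ≡ u ℚ.* v ℚ.- u′ ℚ.* v′
    lemma = solve 4 (λ u v u′ v′ → (u :- u′) :* v :+ (v :- v′) :* u′ := u :* v :- u′ :* v′) ≡.refl

  0<1 : 0ℚ ℚ.< 1ℚ
  0<1 = ℚ.positive⁻¹ 1ℚ

  eventually-bounded : ∀ x → ∃ λ B → 0ℚ ℚ.< B × ∃ λ N → ∀ n → N ℕ.≤ n → ∣ seq x n ∣ ℚ.< B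
  eventually-bounded x with cauchy x 1ℚ 0<1
  ... | N , h = B , 0<B , N , bounded
    where
    B : ℚ
    B = 1ℚ ℚ.+ ∣ seq x N ∣
    0<B : 0ℚ ℚ.< B
    0<B = ℚ.+-mono-<-≤ 0<1 (ℚ.0≤∣p∣ (seq x N))
    lemma : ∀ u v → (u ℚ.- v) ℚ.+ v ≡ u
    lemma = solve 2 (λ u v → (u :- v) :+ v := u) ≡.refl
    bounded : ∀ n → N ℕ.≤ n → ∣ seq x n ∣ ℚ.< B
    bounded n N≤n = ℚ.≤-<-trans
      (subst (λ t → ∣ t ∣ ℚ.≤ ∣ seq x n ℚ.- seq x N ∣ ℚ.+ ∣ seq x N ∣) (lemma (seq x n) (seq x N))
        (ℚ.∣p+q∣≤∣p∣+∣q∣ (seq x n ℚ.- seq x N) (seq x N)))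
      (ℚ.+-mono-<-≤ (h n N N≤n ℕ.≤-refl) ℚ.≤-refl)

open RealLemmas

infixl 6 _+ᵣ_
infixl 7 _*ᵣ_

_+ᵣ_ : ℝ → ℝ → ℝ
seq    (x +ᵣ y) n = seq x n ℚ.+ seq y n
cauchy (x +ᵣ y) ε 0<ε =
  let (N , p) = cauchy x (½ ℚ.* ε) (half-pos 0<ε)
      (M , q) = cauchy y (½ ℚ.* ε) (half-pos 0<ε)
  in N ℕ.⊔ M , λ m n ≤m ≤n → sum-< (seq x m) (seq y m) (seq x n) (seq y n)
       (p m n (ℕ.m⊔n≤o⇒m≤o N M ≤m) (ℕ.m⊔n≤o⇒m≤o N M ≤n))
       (q m n (ℕ.m⊔n≤o⇒n≤o N M ≤m) (ℕ.m⊔n≤o⇒n≤o N M ≤n))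

-ᵣ_ : ℝ → ℝ
seq    (-ᵣ x) n = ℚ.- seq x n
cauchy (-ᵣ x) ε 0<ε =
  let (N , p) = cauchy x ε 0<ε
  in N , λ m n ≤m ≤n → neg-< (seq x m) (seq x n) (p m n ≤m ≤n)

_*ᵣ_ : ℝ → ℝ → ℝ
seq    (x *ᵣ y) n = seq x n ℚ.* seq y n
cauchy (x *ᵣ y) ε 0<ε =
  let (B , 0<B , K , b) = eventually-bounded y
      (D , 0<D , L , d) = eventually-bounded x
      (δ , 0<δ , eB) = tolerance B 0<B (half-pos 0<ε)
      (η , 0<η , eD) = tolerance D 0<D (half-pos 0<ε)
      (N , p) = cauchy x δ 0<δ
      (M , q) = cauchy y η 0<η
  in (K ℕ.⊔ L) ℕ.⊔ (N ℕ.⊔ M) , λ m n ≤m ≤n →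
     let KLm = ℕ.m⊔n≤o⇒m≤o (K ℕ.⊔ L) (N ℕ.⊔ M) ≤m
         KLn = ℕ.m⊔n≤o⇒m≤o (K ℕ.⊔ L) (N ℕ.⊔ M) ≤n
         NMm = ℕ.m⊔n≤o⇒n≤o (K ℕ.⊔ L) (N ℕ.⊔ M) ≤m
         NMn = ℕ.m⊔n≤o⇒n≤o (K ℕ.⊔ L) (N ℕ.⊔ M) ≤n
     in product-< (seq x m) (seq y m) (seq x n) (seq y n) B D 0<B 0<D eB eD
          (b m (ℕ.m⊔n≤o⇒m≤o K L KLm)) (d n (ℕ.m⊔n≤o⇒n≤o K L KLn))
          (p m n (ℕ.m⊔n≤o⇒m≤o N M NMm) (ℕ.m⊔n≤o⇒m≤o N M NMn))
          (q m n (ℕ.m⊔n≤o⇒n≤o N M NMm) (ℕ.m⊔n≤o⇒n≤o N M NMn))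

≗⇒≈ᵣ : ∀ {x y} → (∀ n → seq x n ≡ seq y n) → x ≈ᵣ y
≗⇒≈ᵣ {x} {y} e = mk≈ᵣ λ ε 0<ε → 0 , λ n _ →
  subst (ℚ._< ε) (≡.sym (cong ∣_∣ (≡.trans (cong (ℚ._- seq y n) (e n)) (ℚ.+-inverseʳ (seq y n))))) 0<ε

fromℚ : ℚ → ℝ
seq    (fromℚ q) _ = q
cauchy (fromℚ q) ε 0<ε = 0 , λ _ _ _ _ →
  subst (ℚ._< ε) (≡.sym (cong ∣_∣ (ℚ.+-inverseʳ q))) 0<ε

≈ᵣ-isEquivalence : IsEquivalence _≈ᵣ_
≈ᵣ-isEquivalence = record
  { refl  = ≗⇒≈ᵣ λ _ → ≡.refl
  ; sym   = λ {x} {y} e → mk≈ᵣ λ ε 0<ε →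
      let (N , p) = close e ε 0<ε
      in N , λ n ≤n → flip-< (seq x n) (seq y n) (p n ≤n)
  ; trans = λ {x} {y} {z} e e′ → mk≈ᵣ λ ε 0<ε →
      let (N , p) = close e (½ ℚ.* ε) (half-pos 0<ε)
          (M , q) = close e′ (½ ℚ.* ε) (half-pos 0<ε)
      in N ℕ.⊔ M , λ n ≤n → trans-< (seq x n) (seq y n) (seq z n)
           (p n (ℕ.m⊔n≤o⇒m≤o N M ≤n)) (q n (ℕ.m⊔n≤o⇒n≤o N M ≤n))
  }

+ᵣ-cong : ∀ {x x′ y y′} → x ≈ᵣ x′ → y ≈ᵣ y′ → x +ᵣ y ≈ᵣ x′ +ᵣ y′
+ᵣ-cong {x} {x′} {y} {y′} e e′ = mk≈ᵣ λ ε 0<ε →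
  let (N , p) = close e (½ ℚ.* ε) (half-pos 0<ε)
      (M , q) = close e′ (½ ℚ.* ε) (half-pos 0<ε)
  in N ℕ.⊔ M , λ n ≤n → sum-< (seq x n) (seq y n) (seq x′ n) (seq y′ n)
       (p n (ℕ.m⊔n≤o⇒m≤o N M ≤n)) (q n (ℕ.m⊔n≤o⇒n≤o N M ≤n))

-ᵣ-cong : ∀ {x x′} → x ≈ᵣ x′ → -ᵣ x ≈ᵣ -ᵣ x′
-ᵣ-cong {x} {x′} e = mk≈ᵣ λ ε 0<ε →
  let (N , p) = close e ε 0<ε
  in N , λ n ≤n → neg-< (seq x n) (seq x′ n) (p n ≤n)

*ᵣ-cong : ∀ {x x′ y y′} → x ≈ᵣ x′ → y ≈ᵣ y′ → x *ᵣ y ≈ᵣ x′ *ᵣ y′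
*ᵣ-cong {x} {x′} {y} {y′} e e′ = mk≈ᵣ λ ε 0<ε →
  let (B , 0<B , K , b) = eventually-bounded y
      (D , 0<D , L , d) = eventually-bounded x′
      (δ , 0<δ , eB) = tolerance B 0<B (half-pos 0<ε)
      (η , 0<η , eD) = tolerance D 0<D (half-pos 0<ε)
      (N , p) = close e δ 0<δ
      (M , q) = close e′ η 0<η
  in (K ℕ.⊔ L) ℕ.⊔ (N ℕ.⊔ M) , λ n ≤n →
     let KL = ℕ.m⊔n≤o⇒m≤o (K ℕ.⊔ L) (N ℕ.⊔ M) ≤n
         NM = ℕ.m⊔n≤o⇒n≤o (K ℕ.⊔ L) (N ℕ.⊔ M) ≤n
     in product-< (seq x n) (seq y n) (seq x′ n) (seq y′ n) B D 0<B 0<D eB eD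
          (b n (ℕ.m⊔n≤o⇒m≤o K L KL)) (d n (ℕ.m⊔n≤o⇒n≤o K L KL))
          (p n (ℕ.m⊔n≤o⇒m≤o N M NM)) (q n (ℕ.m⊔n≤o⇒n≤o N M NM))

ℝ-ring : CommutativeRing 0ℓ 0ℓ
ℝ-ring = record
  { Carrier = ℝ ; _≈_ = _≈ᵣ_ ; _+_ = _+ᵣ_ ; _*_ = _*ᵣ_ ; -_ = -ᵣ_ ; 0# = fromℚ 0ℚ ; 1# = fromℚ 1ℚ
  ; isCommutativeRing = record
    { isRing = record
      { +-isAbelianGroup = record
        { isGroup = record
          { isMonoid = record
            { isSemigroup = record
              { isMagma = record { isEquivalence = ≈ᵣ-isEquivalence ; ∙-cong = +ᵣ-cong }
              ; assoc = λ x y z → ≗⇒≈ᵣ λ n → ℚ.+-assoc (seq x n) (seq y n) (seq z n)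
              }
            ; identity = (λ x → ≗⇒≈ᵣ λ n → ℚ.+-identityˡ (seq x n))
                       , (λ x → ≗⇒≈ᵣ λ n → ℚ.+-identityʳ (seq x n))
            }
          ; inverse = (λ x → ≗⇒≈ᵣ λ n → ℚ.+-inverseˡ (seq x n))
                    , (λ x → ≗⇒≈ᵣ λ n → ℚ.+-inverseʳ (seq x n))
          ; ⁻¹-cong = -ᵣ-cong
          }
        ; comm = λ x y → ≗⇒≈ᵣ λ n → ℚ.+-comm (seq x n) (seq y n)
        }
      ; *-cong     = *ᵣ-cong
      ; *-assoc    = λ x y z → ≗⇒≈ᵣ λ n → ℚ.*-assoc (seq x n) (seq y n) (seq z n)
      ; *-identity = (λ x → ≗⇒≈ᵣ λ n → ℚ.*-identityˡ (seq x n))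
                   , (λ x → ≗⇒≈ᵣ λ n → ℚ.*-identityʳ (seq x n))
      ; distrib    = (λ x y z → ≗⇒≈ᵣ λ n → ℚ.*-distribˡ-+ (seq x n) (seq y n) (seq z n))
                   , (λ x y z → ≗⇒≈ᵣ λ n → ℚ.*-distribʳ-+ (seq x n) (seq y n) (seq z n))
      }
    ; *-comm = λ x y → ≗⇒≈ᵣ λ n → ℚ.*-comm (seq x n) (seq y n)
    }
  }

record ℂ : Set where
  no-eta-equality
  field
    re im : ℝ

open ℂ public

infix 4 _≈ᵢ_
record _≈ᵢ_ (w z : ℂ) : Set where
  constructor mk≈ᵢ
  field
    re-≈ : re w ≈ᵣ re z
    im-≈ : im w ≈ᵣ im z

open _≈ᵢ_ public

infixl 6 _+ᵢ_
infixl 7 _*ᵢ_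

_+ᵢ_ _*ᵢ_ : ℂ → ℂ → ℂ
re (w +ᵢ z) = re w +ᵣ re z
im (w +ᵢ z) = im w +ᵣ im z
re (w *ᵢ z) = re w *ᵣ re z +ᵣ (-ᵣ (im w *ᵣ im z))
im (w *ᵢ z) = re w *ᵣ im z +ᵣ im w *ᵣ re z

-ᵢ_ : ℂ → ℂ
re (-ᵢ w) = -ᵣ re w
im (-ᵢ w) = -ᵣ im w

ℚ→ℂ : ℚ → ℂ
re (ℚ→ℂ q) = fromℚ q
im (ℚ→ℂ q) = fromℚ 0ℚ

0ℂ 1ℂ : ℂ
0ℂ = ℚ→ℂ 0ℚ
1ℂ = ℚ→ℂ 1ℚ

module ComplexIdentities {c ℓ} (R : CommutativeRing c ℓ) where

  open CommutativeRing R
  open RingProperties ring using (-1*x≈-x; -0#≈0#)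
  open SemiringSolver commutativeSemiring using (solve; _:+_; _:*_; _:=_)

  -- The semiring solver has no negation, so - x is passed to it as n * x.
  private
    n : Carrier
    n = - 1#

    neg : ∀ x → - x ≈ n * x
    neg x = sym (-1*x≈-x x)

  assoc-re : ∀ a b d e f g → (a * d - b * e) * f - (a * e + b * d) * g ≈
                             a * (d * f - e * g) - b * (d * g + e * f)
  assoc-re a b d e f g = trans (+-cong (*-congʳ (+-congˡ (neg _))) (neg _)) (trans
    (solve 7 (λ n a b d e f g →
      (a :* d :+ n :* (b :* e)) :* f :+ n :* ((a :* e :+ b :* d) :* g) :=
      a :* (d :* f :+ n :* (e :* g)) :+ n :* (b :* (d :* g :+ e :* f))) refl n a b d e f g)
    (sym (+-cong (*-congˡ (+-congˡ (neg _))) (neg _))))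

  assoc-im : ∀ a b d e f g → (a * d - b * e) * g + (a * e + b * d) * f ≈
                             a * (d * g + e * f) + b * (d * f - e * g)
  assoc-im a b d e f g = trans (+-congʳ (*-congʳ (+-congˡ (neg _)))) (trans
    (solve 7 (λ n a b d e f g →
      (a :* d :+ n :* (b :* e)) :* g :+ (a :* e :+ b :* d) :* f :=
      a :* (d :* g :+ e :* f) :+ b :* (d :* f :+ n :* (e :* g))) refl n a b d e f g)
    (sym (+-congˡ (*-congˡ (+-congˡ (neg _))))))

  comm-re : ∀ a b d e → a * d - b * e ≈ d * a - e * b
  comm-re a b d e = +-cong (*-comm a d) (-‿cong (*-comm b e))

  comm-im : ∀ a b d e → a * e + b * d ≈ d * b + e * a
  comm-im a b d e = trans (+-comm _ _) (+-cong (*-comm b d) (*-comm a e))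

  identity-re : ∀ a b → 1# * a - 0# * b ≈ a
  identity-re a b =
    trans (+-cong (*-identityˡ a) (trans (-‿cong (zeroˡ b)) -0#≈0#)) (+-identityʳ a)

  identity-im : ∀ a b → 1# * b + 0# * a ≈ b
  identity-im a b = trans (+-cong (*-identityˡ b) (zeroˡ a)) (+-identityʳ b)

  distrib-re : ∀ a b d e f g → a * (d + f) - b * (e + g) ≈ (a * d - b * e) + (a * f - b * g)
  distrib-re a b d e f g = trans (+-congˡ (neg _)) (trans
    (solve 7 (λ n a b d e f g →
      a :* (d :+ f) :+ n :* (b :* (e :+ g)) :=
      (a :* d :+ n :* (b :* e)) :+ (a :* f :+ n :* (b :* g))) refl n a b d e f g)
    (sym (+-cong (+-congˡ (neg _)) (+-congˡ (neg _)))))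

  distrib-im : ∀ a b d e f g → a * (e + g) + b * (d + f) ≈ (a * e + b * d) + (a * g + b * f)
  distrib-im = solve 6 (λ a b d e f g →
    a :* (e :+ g) :+ b :* (d :+ f) := (a :* e :+ b :* d) :+ (a :* g :+ b :* f)) refl

module ComplexLemmas where

  open CommutativeRing ℝ-ring using (refl; sym; trans)

  ≈ᵢ-isEquivalence : IsEquivalence _≈ᵢ_
  ≈ᵢ-isEquivalence = record
    { refl  = mk≈ᵢ refl refl
    ; sym   = λ e → mk≈ᵢ (sym (re-≈ e)) (sym (im-≈ e))
    ; trans = λ e e′ → mk≈ᵢ (trans (re-≈ e) (re-≈ e′)) (trans (im-≈ e) (im-≈ e′))
    }

  setoidᵢ : Setoid 0ℓ 0ℓ
  setoidᵢ = record { isEquivalence = ≈ᵢ-isEquivalence }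

  +ᵢ-cong : ∀ {w w′ z z′} → w ≈ᵢ w′ → z ≈ᵢ z′ → w +ᵢ z ≈ᵢ w′ +ᵢ z′
  +ᵢ-cong (mk≈ᵢ p q) (mk≈ᵢ r s) = mk≈ᵢ (+ᵣ-cong p r) (+ᵣ-cong q s)

  *ᵢ-cong : ∀ {w w′ z z′} → w ≈ᵢ w′ → z ≈ᵢ z′ → w *ᵢ z ≈ᵢ w′ *ᵢ z′
  *ᵢ-cong (mk≈ᵢ p q) (mk≈ᵢ r s) = mk≈ᵢ
    (+ᵣ-cong (*ᵣ-cong p r) (-ᵣ-cong (*ᵣ-cong q s))) (+ᵣ-cong (*ᵣ-cong p s) (*ᵣ-cong q r))

  open ComplexIdentities ℝ-ring

  *ᵢ-assoc : ∀ w z v → (w *ᵢ z) *ᵢ v ≈ᵢ w *ᵢ (z *ᵢ v)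
  *ᵢ-assoc w z v = mk≈ᵢ
    (assoc-re (re w) (im w) (re z) (im z) (re v) (im v))
    (assoc-im (re w) (im w) (re z) (im z) (re v) (im v))

  *ᵢ-comm : ∀ w z → w *ᵢ z ≈ᵢ z *ᵢ w
  *ᵢ-comm w z = mk≈ᵢ
    (comm-re (re w) (im w) (re z) (im z))
    (comm-im (re w) (im w) (re z) (im z))

  *ᵢ-identityˡ : ∀ w → 1ℂ *ᵢ w ≈ᵢ w
  *ᵢ-identityˡ w = mk≈ᵢ
    (identity-re (re w) (im w))
    (identity-im (re w) (im w))

  *ᵢ-distribˡ : ∀ w z v → w *ᵢ (z +ᵢ v) ≈ᵢ w *ᵢ z +ᵢ w *ᵢ v
  *ᵢ-distribˡ w z v = mk≈ᵢ
    (distrib-re (re w) (im w) (re z) (im z) (re v) (im v))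
    (distrib-im (re w) (im w) (re z) (im z) (re v) (im v))

open ComplexLemmas

ℂ-ring : CommutativeRing 0ℓ 0ℓ
ℂ-ring = record
  { Carrier = ℂ ; _≈_ = _≈ᵢ_ ; _+_ = _+ᵢ_ ; _*_ = _*ᵢ_ ; -_ = -ᵢ_ ; 0# = 0ℂ ; 1# = 1ℂ
  ; isCommutativeRing = record
    { isRing = record
      { +-isAbelianGroup = record
        { isGroup = record
          { isMonoid = record
            { isSemigroup = record
              { isMagma = record
                { isEquivalence = ≈ᵢ-isEquivalence
                ; ∙-cong = +ᵢ-cong
                }
              ; assoc = λ w z v → mk≈ᵢ (R.+-assoc (re w) (re z) (re v)) (R.+-assoc (im w) (im z) (im v))
              }
            ; identity = (λ w → mk≈ᵢ (R.+-identityˡ (re w)) (R.+-identityˡ (im w)))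
                       , (λ w → mk≈ᵢ (R.+-identityʳ (re w)) (R.+-identityʳ (im w)))
            }
          ; inverse = (λ w → mk≈ᵢ (R.-‿inverseˡ (re w)) (R.-‿inverseˡ (im w)))
                    , (λ w → mk≈ᵢ (R.-‿inverseʳ (re w)) (R.-‿inverseʳ (im w)))
          ; ⁻¹-cong = λ e → mk≈ᵢ (-ᵣ-cong (re-≈ e)) (-ᵣ-cong (im-≈ e))
          }
        ; comm = λ w z → mk≈ᵢ (R.+-comm (re w) (re z)) (R.+-comm (im w) (im z))
        }
      ; *-cong     = *ᵢ-cong
      ; *-assoc    = *ᵢ-assoc
      ; *-identity = *ᵢ-identityˡ
                   , comm∧idˡ⇒idʳ setoidᵢ *ᵢ-comm *ᵢ-identityˡ
      ; distrib    = *ᵢ-distribˡ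
                   , comm∧distrˡ⇒distrʳ setoidᵢ +ᵢ-cong *ᵢ-comm *ᵢ-distribˡ
      }
    ; *-comm = *ᵢ-comm
    }
  }
  where module R = CommutativeRing ℝ-ring

open Polynomials ℂ-ring public using (coeff; bound; vanish; coeff-≈; mk≈ₚ; const; X)
  renaming (Polynomial to ℂ[x]; polynomialRing to ℂ[x]-ring)

open CommutativeRing ℂ[x]-ring public using (_≈_; _+_; _*_; 1#)
open SemiringExp (CommutativeRing.semiring ℂ[x]-ring) public using (_^_)
open SemiringMult (CommutativeRing.semiring ℂ[x]-ring) using () renaming (_×_ to _×ₚ_)

infix 9 #_
#_ : ℕ → ℂ[x]
# n = n ×ₚ 1#

ℚ→ℂ[x] : ℚ → ℂ[x]
ℚ→ℂ[x] q = const (ℚ→ℂ q)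

open PowerSeries ℂ[x]-ring public using (monomial; _≈ₛ_; _+ₛ_) renaming (Series to ℂ[x]⟦z⟧)
open Exponential ℂ[x]-ring ℚ→ℂ[x] public using (exp; egf)

{-# OPTIONS --safe #-}

-- The Euler operator θ = z d/dz is a derivation, so F = exp f satisfies θF = θf · F.
-- Comparing coefficients of zⁿ⁺¹ for F = ∑ Pₙ zⁿ/n! and multiplying by n! gives
--   Pₙ₊₁ = ∑_{k ≤ n} C(n,k) (k+1)! fₖ₊₁ Pₙ₋ₖ,
-- and for f = xz + az² + bz⁴ only the terms k = 0, 1, 3 survive.
module Submission where

open import Algebra.Bundles using (CommutativeRing)
import Algebra.Properties.CommutativeMonoid.Mult as CommutativeMonoidMult
import Algebra.Properties.Semiring.Exp as SemiringExp
import Algebra.Properties.Semiring.Mult as SemiringMult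
import Algebra.Properties.Semiring.Sum as SemiringSum
import Algebra.Solver.Ring.NaturalCoefficients.Default as SemiringSolver
open import Data.Fin.Base using (Fin; toℕ; zero; suc)
open import Data.Fin.Properties using (toℕ≤pred[n])
open import Data.Integer.Base as ℤ using (+_)
import Data.Integer.Properties as ℤ
open import Data.Integer.Tactic.RingSolver using (solve-∀)
open import Data.Nat.Base as ℕ using (ℕ; zero; suc; _≥_; _∸_; _!; z≤n; s≤s; NonZero)
open import Data.Nat.Combinatorics using (_C_; nCk≡n!/k![n-k]!; [n∸k]!k!∣n!)
open import Data.Nat.DivMod using (m/n*n≡m)
open import Data.Nat.Divisibility using (_∣_)
import Data.Nat.Properties as ℕ
open import Data.Product.Base using (_×_; _,_)
open import Data.Rational.Base as ℚ using (ℚ; 0ℚ; 1ℚ)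
import Data.Rational.Properties as ℚ
open import Data.Rational.Unnormalised.Base as ℚᵘ using (mkℚᵘ; *≡*)
import Data.Rational.Unnormalised.Properties as ℚᵘ
open import Relation.Binary.PropositionalEquality.Core as ≡ using (_≡_; cong; subst)
import Relation.Binary.Reasoning.Setoid as SetoidReasoning
open import Defs using (module PowerSeries; module Exponential; 1/_!)

-- Factorial and fraction identities

nCk*k![n∸k]!≡n! : ∀ {n k} → k ℕ.≤ n → (n C k) ℕ.* (k ! ℕ.* (n ∸ k) !) ≡ n !
nCk*k![n∸k]!≡n! {n} {k} k≤n = ≡.trans (cong (ℕ._* (k ! ℕ.* (n ∸ k) !)) (nCk≡n!/k![n-k]! k≤n))
  (m/n*n≡m (subst (_∣ n !) (ℕ.*-comm ((n ∸ k) !) (k !)) ([n∸k]!k!∣n! k≤n)))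
  where instance _ = k ℕ.!* (n ∸ k) !≢0

-- Normalised fractions hide their denominators, so both sides are moved to unnormalised rationals,
-- where the claim is a cross-multiplication of integers.
/-homo-+ : ∀ i j d .{{_ : NonZero d}} → i ℚ./ d ℚ.+ j ℚ./ d ≡ (i ℤ.+ j) ℚ./ d
/-homo-+ i j d@(suc d-1) = ℚ.toℚᵘ-injective (begin
  ℚ.toℚᵘ (i ℚ./ d ℚ.+ j ℚ./ d)              ≈⟨ ℚ.toℚᵘ-homo-+ (i ℚ./ d) (j ℚ./ d) ⟩
  ℚ.toℚᵘ (i ℚ./ d) ℚᵘ.+ ℚ.toℚᵘ (j ℚ./ d)    ≈⟨ ℚᵘ.+-cong (ℚ.toℚᵘ-fromℚᵘ (mkℚᵘ i d-1)) (ℚ.toℚᵘ-fromℚᵘ (mkℚᵘ j d-1)) ⟩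
  mkℚᵘ i d-1 ℚᵘ.+ mkℚᵘ j d-1                ≈⟨ *≡* (≡.trans (lemma i j (+ d)) (cong ((i ℤ.+ j) ℤ.*_) (≡.sym (ℤ.pos-* d d)))) ⟩
  mkℚᵘ (i ℤ.+ j) d-1                        ≈⟨ ℚ.toℚᵘ-fromℚᵘ (mkℚᵘ (i ℤ.+ j) d-1) ⟨
  ℚ.toℚᵘ ((i ℤ.+ j) ℚ./ d)                  ∎)
  where
  open SetoidReasoning ℚᵘ.≃-setoid
  lemma : ∀ i j d → (i ℤ.* d ℤ.+ j ℤ.* d) ℤ.* d ≡ (i ℤ.+ j) ℤ.* (d ℤ.* d)
  lemma = solve-∀

m/[m*n]≡1/n : ∀ m n .{{_ : NonZero n}} .{{_ : NonZero (m ℕ.* n)}} → + m ℚ./ (m ℕ.* n) ≡ + 1 ℚ./ n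
m/[m*n]≡1/n (suc m) (suc n) = ℚ.fromℚᵘ-cong {mkℚᵘ (+ suc m) _} {mkℚᵘ (+ 1) n}
  (*≡* (≡.trans (≡.sym (ℤ.pos-* (suc m) (suc n))) (≡.sym (ℤ.*-identityˡ _))))

-- Inverse factorials in a ring with a map from the rationals

module ExponentialRecurrence {c ℓ} (R : CommutativeRing c ℓ) (ι : ℚ → CommutativeRing.Carrier R)
  (ι-homo-0 : CommutativeRing._≈_ R (ι 0ℚ) (CommutativeRing.0# R))
  (ι-homo-1 : CommutativeRing._≈_ R (ι 1ℚ) (CommutativeRing.1# R))
  (ι-homo-+ : ∀ p q → CommutativeRing._≈_ R (ι (p ℚ.+ q)) (CommutativeRing._+_ R (ι p) (ι q)))
  where

  open CommutativeRing R hiding (zero)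
  open SemiringMult semiring renaming (_×_ to infixr 7.5 _·_)
  open CommutativeMonoidMult +-commutativeMonoid using (×-distrib-+)
  open SemiringSum semiring
  open SemiringExp semiring using (_^_)
  open PowerSeries R
  open Exponential R ι
  open SetoidReasoning setoid
  open SemiringSolver commutativeSemiring using (solve; con; _:+_; _:*_; _:=_)

  private
    module S where
      open CommutativeRing seriesRing public
      open SemiringMult (CommutativeRing.semiring seriesRing) public
      open SetoidReasoning (CommutativeRing.setoid seriesRing) public

  -- A natural multiple is a repeated sum, so additivity of `ι` carries it inside. All cancellation
  -- of factorials below goes through this.
  ι-· : ∀ n d .{{_ : NonZero d}} → n · ι (+ 1 ℚ./ d) ≈ ι (+ n ℚ./ d)
  ι-· zero    d = sym (trans (reflexive (cong ι (ℚ.0/n≡0 d))) ι-homo-0)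
  ι-· (suc n) d = begin
    ι (+ 1 ℚ./ d) + n · ι (+ 1 ℚ./ d) ≈⟨ +-congˡ (ι-· n d) ⟩
    ι (+ 1 ℚ./ d) + ι (+ n ℚ./ d)     ≈⟨ ι-homo-+ _ _ ⟨
    ι (+ 1 ℚ./ d ℚ.+ + n ℚ./ d)       ≡⟨ cong ι (/-homo-+ (+ 1) (+ n) d) ⟩
    ι (+ suc n ℚ./ d)                 ∎

  [1+n]·1/[1+n]! : ∀ n → suc n · ι (1/ suc n !) ≈ ι (1/ n !)
  [1+n]·1/[1+n]! n = trans (ι-· (suc n) (suc n !)) (reflexive (cong ι (m/[m*n]≡1/n (suc n) (n !))))
    where instance
      _ = n ℕ.!≢0
      _ = suc n ℕ.!≢0

  n!·1/n! : ∀ n → n ! · ι (1/ n !) ≈ 1#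
  n!·1/n! n = begin
    n ! · ι (1/ n !)                   ≈⟨ ι-· (n !) (n !) ⟩
    -- The denominator is rewritten as `n ! * 1` so that `m/[m*n]≡1/n` applies; the resulting 1/1
    -- computes to `1ℚ`.
    ι (+ (n !) ℚ./ n !)                ≡⟨ cong ι (ℚ./-cong {p₁ = + (n !)} ≡.refl (≡.sym (ℕ.*-identityʳ (n !)))) ⟩
    ι (+ (n !) ℚ./ (n ! ℕ.* 1))        ≡⟨ cong ι (m/[m*n]≡1/n (n !) 1) ⟩
    ι 1ℚ                               ≈⟨ ι-homo-1 ⟩
    1#                                 ∎
    where instance
      _ = n ℕ.!≢0
      _ = ℕ.m*n≢0 (n !) 1

  n!·egf : ∀ P n → n ! · egf P n ≈ P n
  n!·egf P n = begin
    n ! · (ι (1/ n !) * P n) ≈⟨ ×-assoc-* (n !) _ _ ⟨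
    n ! · ι (1/ n !) * P n   ≈⟨ *-congʳ (n!·1/n! n) ⟩
    1# * P n                 ≈⟨ *-identityˡ _ ⟩
    P n                      ∎

  -- Since n! = C(n,k) k! (n-k)!, the last factor cancels the denominator in `egf P (n ∸ k)`. This
  -- is where the binomial coefficients enter.
  n!·egf[n∸k] : ∀ P {n k} → k ℕ.≤ n → n ! · egf P (n ∸ k) ≈ ((n C k) ℕ.* k !) · P (n ∸ k)
  n!·egf[n∸k] P {n} {k} k≤n = begin
    n ! · egf P (n ∸ k)
      ≡⟨ cong (_· egf P (n ∸ k)) (≡.trans (ℕ.*-assoc (n C k) (k !) _) (nCk*k![n∸k]!≡n! k≤n)) ⟨
    ((n C k) ℕ.* k ! ℕ.* (n ∸ k) !) · egf P (n ∸ k)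
      ≈⟨ ×-assocˡ _ ((n C k) ℕ.* k !) ((n ∸ k) !) ⟨
    ((n C k) ℕ.* k !) · ((n ∸ k) ! · egf P (n ∸ k))
      ≈⟨ ×-congʳ ((n C k) ℕ.* k !) (n!·egf P (n ∸ k)) ⟩
    ((n C k) ℕ.* k !) · P (n ∸ k) ∎

  -- Finite sums

  sum-zero : ∀ {n} (t : Fin n → Carrier) → (∀ i → t i ≈ 0#) → sum t ≈ 0#
  sum-zero {n} t t≈0 = trans (sum-cong-≋ t≈0) (sum-replicate-zero n)

  ·-distrib-sum : ∀ {n} m (t : Fin n → Carrier) → m · sum t ≈ sum (λ i → m · t i)
  -- The empty sum needs m · 0 = 0: write 0 as 0 * 0 and pull one factor out of the multiple.
  ·-distrib-sum {zero}  m t = trans (×-congʳ m (sym (zeroˡ 0#)))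
    (trans (sym (×-comm-* m 0# 0#)) (zeroˡ _))
  ·-distrib-sum {suc n} m t =
    trans (×-distrib-+ (t zero) _ m) (+-congˡ (·-distrib-sum m (λ i → t (suc i))))

  ∑-truncate : ∀ (g : ℕ → Carrier) {n N} → n ℕ.≤ N → (∀ k → n ℕ.< k → g k ≈ 0#) →
               ∑[ k ≤ N ] g (toℕ k) ≈ ∑[ k ≤ n ] g (toℕ k)
  ∑-truncate g {N = N} z≤n g≈0 = +-congˡ (sum-zero {N} _ λ k → g≈0 _ (s≤s z≤n))
  ∑-truncate g (s≤s n≤N)   g≈0 = +-congˡ (∑-truncate (λ k → g (suc k)) n≤N λ k n<k → g≈0 (suc k) (s≤s n<k))

  -- The Euler operator

  θ : Series → Series
  θ f n = n · f n

  -- `θ` does not shift indices, so the Leibniz rule holds term by term in the Cauchy product: n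
  -- splits as i + (n ∸ i), one part for each factor.
  θ-* : ∀ f g → θ (f *ₛ g) ≈ₛ θ f *ₛ g +ₛ f *ₛ θ g
  θ-* f g n = begin
    n · (∑[ i ≤ n ] (f (toℕ i) * g (n ∸ toℕ i)))
      ≈⟨ ·-distrib-sum n (λ (i : Fin (suc n)) → f (toℕ i) * g (n ∸ toℕ i)) ⟩
    ∑[ i ≤ n ] (n · (f (toℕ i) * g (n ∸ toℕ i)))
      ≈⟨ sum-cong-≋ {suc n} (λ i → split (toℕ≤pred[n] i)) ⟩
    ∑[ i ≤ n ] (θ f (toℕ i) * g (n ∸ toℕ i) + f (toℕ i) * θ g (n ∸ toℕ i))
      ≈⟨ ∑-distrib-+ {suc n} (λ i → θ f (toℕ i) * g (n ∸ toℕ i)) (λ i → f (toℕ i) * θ g (n ∸ toℕ i)) ⟩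
    (θ f *ₛ g +ₛ f *ₛ θ g) n ∎
    where
    split : ∀ {i} → i ℕ.≤ n → n · (f i * g (n ∸ i)) ≈ θ f i * g (n ∸ i) + f i * θ g (n ∸ i)
    split {i} i≤n = begin
      n · (f i * g (n ∸ i))
        ≡⟨ cong (_· (f i * g (n ∸ i))) (ℕ.m+[n∸m]≡n i≤n) ⟨
      (i ℕ.+ (n ∸ i)) · (f i * g (n ∸ i))
        ≈⟨ ×-homo-+ _ i (n ∸ i) ⟩
      i · (f i * g (n ∸ i)) + (n ∸ i) · (f i * g (n ∸ i))
        ≈⟨ +-cong (×-assoc-* i _ _) (×-comm-* (n ∸ i) _ _) ⟨
      θ f i * g (n ∸ i) + f i * θ g (n ∸ i) ∎

  θ-1 : θ 1ₛ ≈ₛ 0ₛ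
  θ-1 zero    = refl
  θ-1 (suc n) = trans (+-identityˡ _) (·-distrib-sum {0} n λ ())

  θ-^ : ∀ f k → θ (f ^ₛ suc k) ≈ₛ suc k S.× (θ f *ₛ f ^ₛ k)
  θ-^ f zero = S.begin
    θ (f *ₛ 1ₛ)              S.≈⟨ θ-* f 1ₛ ⟩
    θ f *ₛ 1ₛ +ₛ f *ₛ θ 1ₛ   S.≈⟨ S.+-congˡ {x = θ f *ₛ 1ₛ} (S.trans (S.*-congˡ {x = f} θ-1) (S.zeroʳ f)) ⟩
    θ f *ₛ 1ₛ +ₛ 0ₛ          S.∎
  θ-^ f (suc k) = S.begin
    θ (f *ₛ f ^ₛ suc k)
      S.≈⟨ θ-* f (f ^ₛ suc k) ⟩
    θ f *ₛ f ^ₛ suc k +ₛ f *ₛ θ (f ^ₛ suc k)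
      S.≈⟨ S.+-congˡ {x = θ f *ₛ f ^ₛ suc k} (S.begin
        f *ₛ θ (f ^ₛ suc k)              S.≈⟨ S.*-congˡ {x = f} (θ-^ f k) ⟩
        f *ₛ (suc k S.× (θ f *ₛ f ^ₛ k)) S.≈⟨ S.×-comm-* (suc k) f (θ f *ₛ f ^ₛ k) ⟩
        suc k S.× (f *ₛ (θ f *ₛ f ^ₛ k)) S.≈⟨ S.×-congʳ (suc k) (S.begin
          f *ₛ (θ f *ₛ f ^ₛ k)   S.≈⟨ *ₛ-assoc f (θ f) (f ^ₛ k) ⟨
          f *ₛ θ f *ₛ f ^ₛ k     S.≈⟨ S.*-congʳ {x = f ^ₛ k} (*ₛ-comm f (θ f)) ⟩
          θ f *ₛ f *ₛ f ^ₛ k     S.≈⟨ *ₛ-assoc (θ f) f (f ^ₛ k) ⟩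
          θ f *ₛ (f *ₛ f ^ₛ k)   S.∎) ⟩
        suc k S.× (θ f *ₛ f ^ₛ suc k)    S.∎) ⟩
    -- By definition a (k+2)-fold multiple is one copy plus a (k+1)-fold multiple, which is the sum
    -- just reached.
    suc (suc k) S.× (θ f *ₛ f ^ₛ suc k) S.∎

  -- Truncated exponentials

  ·-coefficient : ∀ k f n → (k S.× f) n ≈ k · f n
  ·-coefficient zero    f n = refl
  ·-coefficient (suc k) f n = +-congˡ (·-coefficient k f n)

  -- In `exp` the cut-off moves with the coefficient index. A cut-off fixed for all coefficients
  -- makes this a genuine linear combination of powers, to which `θ` applies termwise.
  partialExp : ℕ → Series → Series
  partialExp N f n = ∑[ k ≤ N ] (ι (1/ toℕ k !) * (f ^ₛ toℕ k) n)

  partialExp≈exp : ∀ {f} → f 0 ≈ 0# → ∀ {n N} → n ℕ.≤ N → partialExp N f n ≈ exp f n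
  partialExp≈exp {f} f₀≈0 {n} n≤N = ∑-truncate (λ k → ι (1/ k !) * (f ^ₛ k) n) n≤N
    λ k n<k → trans (*-congˡ (^ₛ-vanish {f} f₀≈0 k n n<k)) (zeroʳ _)

  -- `θ` kills the constant term and sends fᵏ⁺¹/(k+1)! to θf · fᵏ/k!, so the cut-off drops by one.
  θ-partialExp : ∀ f N → θ (partialExp (suc N) f) ≈ₛ θ f *ₛ partialExp N f
  θ-partialExp f N n = begin
    n · partialExp (suc N) f n
      ≈⟨ ·-distrib-sum {suc (suc N)} n (λ k → ι (1/ toℕ k !) * (f ^ₛ toℕ k) n) ⟩
    n · (ι (1/ 0 !) * 1ₛ n) + ∑[ k ≤ N ] (n · (ι (1/ suc (toℕ k) !) * (f ^ₛ suc (toℕ k)) n))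
      ≈⟨ +-cong (trans (sym (×-comm-* n _ _)) (trans (*-congˡ (θ-1 n)) (zeroʳ _)))
                (sum-cong-≋ {suc N} λ k → term (toℕ k)) ⟩
    0# + ∑[ k ≤ N ] (ι (1/ toℕ k !) * (θ f *ₛ f ^ₛ toℕ k) n)
      ≈⟨ +-identityˡ _ ⟩
    ∑[ k ≤ N ] (ι (1/ toℕ k !) * (θ f *ₛ f ^ₛ toℕ k) n)
      ≈⟨ sum-cong-≋ {suc N} (λ k → trans
           (*-distribˡ-sum {suc n} (ι (1/ toℕ k !)) (λ i → θ f (toℕ i) * (f ^ₛ toℕ k) (n ∸ toℕ i)))
           (sum-cong-≋ {suc n} λ i → exchange (ι (1/ toℕ k !)) (θ f (toℕ i)) ((f ^ₛ toℕ k) (n ∸ toℕ i)))) ⟩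
    ∑[ k ≤ N ] ∑[ i ≤ n ] (θ f (toℕ i) * (ι (1/ toℕ k !) * (f ^ₛ toℕ k) (n ∸ toℕ i)))
      -- The cut-off `N` does not depend on the Cauchy index `i`, so the two sums can be exchanged.
      ≈⟨ ∑-comm {suc N} {suc n} (λ k i → θ f (toℕ i) * (ι (1/ toℕ k !) * (f ^ₛ toℕ k) (n ∸ toℕ i))) ⟩
    ∑[ i ≤ n ] ∑[ k ≤ N ] (θ f (toℕ i) * (ι (1/ toℕ k !) * (f ^ₛ toℕ k) (n ∸ toℕ i)))
      ≈⟨ sum-cong-≋ {suc n} (λ i → *-distribˡ-sum {suc N} (θ f (toℕ i))
           (λ k → ι (1/ toℕ k !) * (f ^ₛ toℕ k) (n ∸ toℕ i))) ⟨
    (θ f *ₛ partialExp N f) n ∎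
    where
    exchange : ∀ x y z → x * (y * z) ≈ y * (x * z)
    exchange = solve 3 (λ x y z → x :* (y :* z) := y :* (x :* z)) refl

    term : ∀ k → n · (ι (1/ suc k !) * (f ^ₛ suc k) n) ≈ ι (1/ k !) * (θ f *ₛ f ^ₛ k) n
    term k = begin
      n · (ι (1/ suc k !) * (f ^ₛ suc k) n)          ≈⟨ ×-comm-* n _ _ ⟨
      ι (1/ suc k !) * θ (f ^ₛ suc k) n              ≈⟨ *-congˡ (trans (θ-^ f k n) (·-coefficient (suc k) (θ f *ₛ f ^ₛ k) n)) ⟩
      ι (1/ suc k !) * (suc k · (θ f *ₛ f ^ₛ k) n)   ≈⟨ ×-comm-* (suc k) _ _ ⟩
      suc k · (ι (1/ suc k !) * (θ f *ₛ f ^ₛ k) n)   ≈⟨ ×-assoc-* (suc k) _ _ ⟨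
      suc k · ι (1/ suc k !) * (θ f *ₛ f ^ₛ k) n     ≈⟨ *-congʳ ([1+n]·1/[1+n]! k) ⟩
      ι (1/ k !) * (θ f *ₛ f ^ₛ k) n                 ∎

  exp-recurrence : ∀ {f} → f 0 ≈ 0# → ∀ n →
                   suc n · exp f (suc n) ≈ ∑[ k ≤ n ] (θ f (suc (toℕ k)) * exp f (n ∸ toℕ k))
  exp-recurrence {f} f₀≈0 n = begin
    suc n · exp f (suc n)
      -- At coefficient `suc n` the cut-off `suc n` is `exp` by definition. The lowered cut-off `n`
      -- still covers every index `n ∸ k` on the right, and the leading Cauchy term has the factor
      -- `θ f 0`, which reduces to `0#`.
      ≈⟨ θ-partialExp f n (suc n) ⟩
    0# * partialExp n f (suc n) + ∑[ k ≤ n ] (θ f (suc (toℕ k)) * partialExp n f (n ∸ toℕ k))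
      ≈⟨ trans (+-congʳ (zeroˡ _)) (+-identityˡ _) ⟩
    ∑[ k ≤ n ] (θ f (suc (toℕ k)) * partialExp n f (n ∸ toℕ k))
      ≈⟨ sum-cong-≋ {suc n} (λ k → *-congˡ {x = θ f (suc (toℕ k))} (partialExp≈exp {f} f₀≈0 (ℕ.m∸n≤m n (toℕ k)))) ⟩
    ∑[ k ≤ n ] (θ f (suc (toℕ k)) * exp f (n ∸ toℕ k)) ∎

  -- Recurrence for a general exponent

  #_ : ℕ → Carrier
  # n = n · 1#

  module _ {f P} (f₀≈0 : f 0 ≈ 0#) (egf≈exp : egf P ≈ₛ exp f) where

    egf-zero : P 0 ≈ 1#
    egf-zero = begin
      P 0                  ≈⟨ n!·egf P 0 ⟨
      1 · egf P 0          ≈⟨ ×-congʳ 1 (egf≈exp 0) ⟩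
      1 · (ι 1ℚ * 1# + 0#) ≈⟨ ×-homo-1 _ ⟩
      ι 1ℚ * 1# + 0#       ≈⟨ trans (+-identityʳ _) (*-identityʳ _) ⟩
      ι 1ℚ                 ≈⟨ ι-homo-1 ⟩
      1#                   ∎

    -- The factor (k+1)! joins k+1 from `θ` with k! from the binomial identity; at k = 1 and k = 3
    -- it supplies the constants 2 and 24.
    egf-recurrence : ∀ n → P (suc n) ≈
      ∑[ k ≤ n ] (# (suc (toℕ k) !) * f (suc (toℕ k)) * # (n C toℕ k) * P (n ∸ toℕ k))
    egf-recurrence n = begin
      P (suc n)
        ≈⟨ n!·egf P (suc n) ⟨
      (suc n ℕ.* n !) · egf P (suc n)
        -- Of (n+1)!, the factor n+1 is used up by `exp-recurrence`, and n! is left for the binomial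
        -- coefficients.
        ≡⟨ cong (_· egf P (suc n)) (ℕ.*-comm (suc n) (n !)) ⟩
      (n ! ℕ.* suc n) · egf P (suc n)
        ≈⟨ ×-assocˡ _ (n !) (suc n) ⟨
      n ! · (suc n · egf P (suc n))
        ≈⟨ ×-congʳ (n !) (trans (×-congʳ (suc n) (egf≈exp (suc n))) (exp-recurrence {f} f₀≈0 n)) ⟩
      n ! · (∑[ k ≤ n ] (θ f (suc (toℕ k)) * exp f (n ∸ toℕ k)))
        ≈⟨ ·-distrib-sum {suc n} (n !) (λ k → θ f (suc (toℕ k)) * exp f (n ∸ toℕ k)) ⟩
      ∑[ k ≤ n ] (n ! · (θ f (suc (toℕ k)) * exp f (n ∸ toℕ k)))
        ≈⟨ sum-cong-≋ {suc n} (λ k → term (toℕ≤pred[n] k)) ⟩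
      ∑[ k ≤ n ] (# (suc (toℕ k) !) * f (suc (toℕ k)) * # (n C toℕ k) * P (n ∸ toℕ k)) ∎
      where
      ·-as-* : ∀ m x → m · x ≈ # m * x
      ·-as-* m x = sym (trans (×-assoc-* m 1# x) (×-congʳ m (*-identityˡ x)))

      term : ∀ {k} → k ℕ.≤ n → n ! · (θ f (suc k) * exp f (n ∸ k)) ≈
             # (suc k !) * f (suc k) * # (n C k) * P (n ∸ k)
      term {k} k≤n = begin
        n ! · (θ f (suc k) * exp f (n ∸ k))
          ≈⟨ ×-comm-* (n !) _ _ ⟨
        θ f (suc k) * (n ! · exp f (n ∸ k))
          ≈⟨ *-congˡ (trans (×-congʳ (n !) (sym (egf≈exp (n ∸ k)))) (n!·egf[n∸k] P k≤n)) ⟩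
        suc k · f (suc k) * (((n C k) ℕ.* k !) · P (n ∸ k))
          ≈⟨ *-cong (·-as-* (suc k) _) (trans (·-as-* ((n C k) ℕ.* k !) _) (*-congʳ (×1-homo-* (n C k) (k !)))) ⟩
        # suc k * f (suc k) * (# (n C k) * # (k !) * P (n ∸ k))
          ≈⟨ solve 5 (λ s f b t p → s :* f :* (b :* t :* p) := s :* t :* f :* b :* p) refl
               (# suc k) (f (suc k)) (# (n C k)) (# (k !)) (P (n ∸ k)) ⟩
        # suc k * # (k !) * f (suc k) * # (n C k) * P (n ∸ k)
          ≈⟨ *-congʳ (*-congʳ (*-congʳ (×1-homo-* (suc k) (k !)))) ⟨
        # (suc k !) * f (suc k) * # (n C k) * P (n ∸ k) ∎

  -- The exponent xz + az² + bz⁴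

  module _ {x a b P} (egf≈exp : egf P ≈ₛ exp (monomial x 1 +ₛ monomial a 2 +ₛ monomial b 4)) where

    private
      f : Series
      f = monomial x 1 +ₛ monomial a 2 +ₛ monomial b 4

      f₀≈0 : f 0 ≈ 0#
      f₀≈0 = trans (+-identityʳ _) (+-identityʳ _)

      recurrence : ∀ n → P (suc n) ≈
        ∑[ k ≤ n ] (# (suc (toℕ k) !) * f (suc (toℕ k)) * # (n C toℕ k) * P (n ∸ toℕ k))
      recurrence = egf-recurrence {f} {P} f₀≈0 egf≈exp

    quartic-zero : P 0 ≈ 1#
    quartic-zero = egf-zero {f} {P} f₀≈0 egf≈exp

    quartic-one : P 1 ≈ x
    quartic-one = trans (recurrence 0) (trans
      -- The expressions mirror the unfolded recurrence: `# 1` is `1# + 0#`, and `f 1` is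
      -- `x + 0# + 0#`.
      (solve 2 (λ x p → (con 1 :+ con 0) :* (x :+ con 0 :+ con 0) :* (con 1 :+ con 0) :* p :+ con 0
                     := x :* p) refl x (P 0))
      (trans (*-congˡ quartic-zero) (*-identityʳ x)))

    quartic-two : P 2 ≈ # 2 * a + x ^ 2
    quartic-two = trans (recurrence 1) (trans
      (+-cong (*-congˡ quartic-one) (+-congʳ (*-congˡ quartic-zero)))
      (solve 2 (λ x a →
        (con 1 :+ con 0) :* (x :+ con 0 :+ con 0) :* (con 1 :+ con 0) :* x :+
        (two :* (con 0 :+ a :+ con 0) :* (con 1 :+ con 0) :* con 1 :+ con 0)
        := two :* a :+ x :* (x :* con 1)) refl x a))
      where two = λ {n} → con {n} 1 :+ (con 1 :+ con 0)

    quartic-three : P 3 ≈ # 6 * a * x + x ^ 3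
    quartic-three = trans (recurrence 2) (trans
      -- The exponent has no z³ term, so the k = 2 summand vanishes and its factors `# 6` and `P 0`
      -- stay opaque as `s` and `p`.
      (+-cong (*-congˡ quartic-two) (+-cong (*-congˡ quartic-one) (+-congʳ (*-congʳ (*-congʳ (*-congˡ f₃≈0))))))
      (solve 4 (λ x a s p →
        (con 1 :+ con 0) :* (x :+ con 0 :+ con 0) :* (con 1 :+ con 0) :* (two :* a :+ x :* (x :* con 1)) :+
        (two :* (con 0 :+ a :+ con 0) :* two :* x :+ (s :* con 0 :* (con 1 :+ con 0) :* p :+ con 0))
        -- The 6 is 2 + 4: 2ax comes from x P₂, and 4ax from 2a C(2,1) P₁.
        := (con 1 :+ (con 1 :+ (con 1 :+ (con 1 :+ two)))) :* a :* x :+ x :* (x :* (x :* con 1)))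
        refl x a (# 6) (P 0)))
      where
      two = λ {n} → con {n} 1 :+ (con 1 :+ con 0)
      f₃≈0 : f 3 ≈ 0#
      f₃≈0 = trans (+-identityʳ _) (+-identityʳ _)

    quartic-recurrence : ∀ m → P (4 ℕ.+ m) ≈
      x * P (3 ℕ.+ m) + # 2 * a * # ((3 ℕ.+ m) C 1) * P (2 ℕ.+ m) + # 24 * b * # ((3 ℕ.+ m) C 3) * P m
    quartic-recurrence m = trans (recurrence (3 ℕ.+ m)) (trans
      -- Four congruences pass the summands k = 0 to 3; the other `m` involve coefficients of `f`
      -- from z⁵ on, where all three monomials compute to `0#`.
      (+-congˡ (+-congˡ (+-congˡ (+-congˡ (sum-zero {m} _ λ i → vanishing _ _ _)))))
      (combine x a b _ _ _ _ _ _ _ _ _ _))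
      where
      -- Factorials and binomial coefficients enter as variables, so the solver never expands a
      -- numeral such as 24.
      combine : ∀ x a b d₂ d₃ d₄ c₁ c₂ c₃ p₃ p₂ p₁ p₀ →
        (1# + 0#) * (x + 0# + 0#) * (1# + 0#) * p₃ + (d₂ * (0# + a + 0#) * c₁ * p₂ +
          (d₃ * (0# + 0# + 0#) * c₂ * p₁ + (d₄ * (0# + 0# + b) * c₃ * p₀ + 0#)))
        ≈ x * p₃ + d₂ * a * c₁ * p₂ + d₄ * b * c₃ * p₀
      combine = solve 13 (λ x a b d₂ d₃ d₄ c₁ c₂ c₃ p₃ p₂ p₁ p₀ →
        (con 1 :+ con 0) :* (x :+ con 0 :+ con 0) :* (con 1 :+ con 0) :* p₃ :+
          (d₂ :* (con 0 :+ a :+ con 0) :* c₁ :* p₂ :+ (d₃ :* (con 0 :+ con 0 :+ con 0) :* c₂ :* p₁ :+ (d₄ :* (con 0 :+ con 0 :+ b) :* c₃ :* p₀ :+ con 0)))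
        := x :* p₃ :+ d₂ :* a :* c₁ :* p₂ :+ d₄ :* b :* c₃ :* p₀) refl
      vanishing : ∀ u v w → u * (0# + 0# + 0#) * v * w ≈ 0#
      vanishing = solve 3 (λ u v w → u :* (con 0 :+ con 0 :+ con 0) :* v :* w := con 0) refl

open import Defs

-- Specialisation to complex polynomials

module _ where

  open CommutativeRing ℂ-ring using (refl; sym; +-identityʳ)
  open Polynomials ℂ-ring using (_≈ₚ_; _+ₚ_; 0ₚ)

  ℚ→ℂ[x]-homo-0 : ℚ→ℂ[x] 0ℚ ≈ₚ 0ₚ
  ℚ→ℂ[x]-homo-0 = mk≈ₚ λ { zero → refl ; (suc _) → refl }

  ℚ→ℂ[x]-homo-+ : ∀ p q → ℚ→ℂ[x] (p ℚ.+ q) ≈ₚ ℚ→ℂ[x] p +ₚ ℚ→ℂ[x] q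
  ℚ→ℂ[x]-homo-+ p q = mk≈ₚ λ where
    zero    → mk≈ᵢ (≗⇒≈ᵣ λ _ → ≡.refl) (≗⇒≈ᵣ λ _ → ≡.refl)
    (suc _) → sym (+-identityʳ _)

open ExponentialRecurrence ℂ[x]-ring ℚ→ℂ[x]
  -- Preservation of one is reflexivity: the unit polynomial is by definition the constant `1ℂ`,
  -- which is `ℚ→ℂ 1ℚ`.
  ℚ→ℂ[x]-homo-0 (CommutativeRing.refl ℂ[x]-ring) ℚ→ℂ[x]-homo-+
  using (quartic-zero; quartic-one; quartic-two; quartic-three; quartic-recurrence)

theorem16 : (a b : ℂ) (P : ℕ → ℂ[x]) →
  egf P ≈ₛ exp (monomial X 1 +ₛ monomial (const a) 2 +ₛ monomial (const b) 4) →
  (∀ n → n ≥ 4 →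
    P n ≈ X * P (n ∸ 1)
          + # 2 * const a * # ((n ∸ 1) C 1) * P (n ∸ 2)
          + # 24 * const b * # ((n ∸ 1) C 3) * P (n ∸ 4))
  × P 0 ≈ 1#
  × P 1 ≈ X
  × P 2 ≈ # 2 * const a + X ^ 2
  × P 3 ≈ # 6 * const a * X + X ^ 3
theorem16 a b P egf≈exp =
    -- Matching the bound exposes n as 4 + m, so the truncated subtractions compute to 3 + m, 2 + m
    -- and m.
    (λ { _ (s≤s (s≤s (s≤s (s≤s (z≤n {m}))))) → quartic-recurrence egf≈exp m })
  , quartic-zero egf≈exp
  , quartic-one egf≈exp
  , quartic-two egf≈exp
  , quartic-three egf≈exp
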